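{- Let $\mathbb{P}$ be the polyhedron of feasible points of the STT LP for a tree topology $U$, and let $P\in\mathbb{P}$ be an integer point. If $P$ is induced by some STT $T$, then $P$ is a vertex on the lower envelope of $\mathbb{P}$. Moreover, if the projection $P_D$ of $P$ to the $D$ coordinates is a vertex on the lower envelope of the projection $\mathbb{P}_D$ of $\mathbb{P}$ to the $D$ coordinates, then $P$ is induced by some STT.
   Context: For a tree $U$ and distinct nodes $i,j$, $(i\leftrightsquigarrow j)$ denotes the nodes strictly between $i$ and $j$ on the $U$-path. An STT $T$ over $U$: pick a node $r$ as root; its subtrees are STTs built recursively over the components of $U\setminus\{r\}$. The STT LP for $U$ has variables $D_i$, $X_{ij}$ ($i\ne j$), $Z_{kij}=Z_{kji}$ ($k\in(i\leftrightsquigarrow j)$); constraints $X,Z\ge0$; $X_{ij}+X_{ji}+\sum_{k\in(i\leftrightsquigarrow j)}Z_{kij}\ge1$; $Z_{kij}\le X_{ki}$, $Z_{kij}\le X_{kj}$; $D_i\ge\sum_{j\ne i}X_{ji}$; objectives are of the form minimize $\sum_i w_iD_i$. The point induced by STT $T$ has $X_{ij}=1$ iff $i$ is a proper ancestor of $j$ in $T$, $Z_{kij}=1$ iff $k$ is the lowest common ancestor of $i$ and $j$ in $T$, other $X,Z$ zero, and $D_i=\sum_{j\ne i}X_{ji}$. A vertex of $\mathbb{P}$ (resp. $\mathbb{P}_D$) is on the lower envelope if there is a weight vector $w\in\mathbb{R}^n$ with nonnegative coordinates such that it is the unique minimizer of $\sum_i w_iD_i$ over $\mathbb{P}$ (resp.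 $\mathbb{P}_D$).
   Formalization: The polyhedron, its projection to the D coordinates and the weight vectors w are taken over the rational numbers instead of the reals; being on the lower envelope means being the unique minimizer among rational feasible points for some nonnegative rational w. -}

module Defs where

open import Data.Nat using (ℕ; zero; suc)
open import Data.Fin using (Fin; zero; suc)
open import Data.Integer using (ℤ)
open import Data.Rational using (ℚ; 0ℚ; 1ℚ; _≤_; _+_; _*_; _/_)
open import Data.List using (List; []; _∷_; [_])
open import Data.List.Relation.Unary.All using (All)
open import Data.List.Relation.Unary.Any using (Any)
open import Data.List.Relation.Unary.AllPairs using (AllPairs)
open import Data.List.Relation.Unary.Unique.Propositional using (Unique)
open import Data.List.Membership.Propositional using (_∈_)
open import Data.Product using (Σ; ∃; ∃-syntax; _×_; _,_)
open import Data.Empty using (⊥)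
open import Data.Unit using (⊤)
open import Data.Sum using (_⊎_)
open import Relation.Nullary using (¬_)
open import Relation.Binary.PropositionalEquality using (_≡_; _≢_)

module _ {n : ℕ} (Adj : Fin n → Fin n → Set) where

  data Walk : Fin n → Fin n → List (Fin n) → Set where
    stop : ∀ {i} → Walk i i [ i ]
    step : ∀ {i k j p} → Adj i k → Walk k j p → Walk i j (i ∷ p)

  IsPath : Fin n → Fin n → List (Fin n) → Set
  IsPath i j p = Walk i j p × Unique p

record Tree (n : ℕ) : Set₁ where
  field
    Adj       : Fin n → Fin n → Set
    Adj-sym   : ∀ {i j} → Adj i j → Adj j i
    Adj-irr   : ∀ {i} → ¬ Adj i i
    uniquePath : ∀ i j → ∃[ p ] (IsPath Adj i j p × (∀ q → IsPath Adj i j q → q ≡ p))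

open Tree public

Between : ∀ {n} → Tree n → Fin n → Fin n → Fin n → Set
Between U k i j = ∃[ p ] (IsPath (Adj U) i j p × k ∈ p × k ≢ i × k ≢ j)

IsComponent : ∀ {n} → Tree n → (Fin n → Set) → (Fin n → Set) → Set
IsComponent {n} U S C =
    (∀ x → C x → S x)
  × (∀ x y → C x → C y → ∃[ p ] (Walk (Adj U) x y p × All S p))
  × (∀ x y → C x → S y → Adj U x y → C y)

data RT (n : ℕ) : Set where
  node : Fin n → List (RT n) → RT n

data _∈T_ {n : ℕ} (x : Fin n) : RT n → Set where
  here  : ∀ {ts} → x ∈T node x ts
  there : ∀ {r ts} → Any (x ∈T_) ts → x ∈T node r ts

data Anc {n : ℕ} : RT n → Fin n → Fin n → Set where
  root   : ∀ {i j ts} → Any (j ∈T_) ts → Anc (node i ts) i j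
  deeper : ∀ {r i j ts} → Any (λ t → Anc t i j) ts → Anc (node r ts) i j

AncEq : ∀ {n} → RT n → Fin n → Fin n → Set
AncEq T i j = (i ≡ j × j ∈T T) ⊎ Anc T i j

IsLCA : ∀ {n} → RT n → Fin n → Fin n → Fin n → Set
IsLCA T k i j = AncEq T k i × AncEq T k j × (∀ m → Anc T k m → ¬ (AncEq T m i × AncEq T m j))

-- IsSTT U S T : T is an STT built over the node set S (which is connected in U):
-- its root r is in S, and its subtrees are STTs over the connected components of
-- S ∖ {r}, each component being the node set of exactly one subtree.
data IsSTT {n : ℕ} (U : Tree n) : (Fin n → Set) → RT n → Set₁ where
  mk : ∀ {S r ts}
     → S r
     → All (λ t → IsComponent U (λ x → S x × x ≢ r) (_∈T t) × IsSTT U (_∈T t) t) ts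
     → (∀ x → S x → x ≢ r → Any (x ∈T_) ts)
     → AllPairs (λ t t' → ∀ x → x ∈T t → x ∈T t' → ⊥) ts
     → IsSTT U S (node r ts)

IsSTTOver : ∀ {n} → Tree n → RT n → Set₁
IsSTTOver {n} U T = IsSTT U (λ _ → ⊤) T

Σℚ : ∀ {n} → (Fin n → ℚ) → ℚ
Σℚ {zero}  f = 0ℚ
Σℚ {suc n} f = f zero + Σℚ (λ i → f (suc i))

-- a point: coordinates D_i, X_ij, Z_kij (coordinates outside the LP's index
-- set, i.e. X_ii and Z_kij with k ∉ (i⇝j), are forced to be 0 by feasibility)
record Point (n : ℕ) : Set where
  constructor pt
  field
    D : Fin n → ℚ
    X : Fin n → Fin n → ℚ
    Z : Fin n → Fin n → Fin n → ℚ

open Point public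

Feasible : ∀ {n} → Tree n → Point n → Set
Feasible U P =
    (∀ i j → 0ℚ ≤ X P i j)
  × (∀ k i j → 0ℚ ≤ Z P k i j)
  × (∀ i → X P i i ≡ 0ℚ)
  × (∀ k i j → ¬ Between U k i j → Z P k i j ≡ 0ℚ)
  × (∀ k i j → Z P k i j ≡ Z P k j i)
  × (∀ i j → i ≢ j → 1ℚ ≤ (X P i j + X P j i) + Σℚ (λ k → Z P k i j))
  × (∀ k i j → Between U k i j → (Z P k i j ≤ X P k i) × (Z P k i j ≤ X P k j))
  × (∀ i → Σℚ (λ j → X P j i) ≤ D P i)

_≐_ : ∀ {n} → Point n → Point n → Set
P ≐ Q = (∀ i → D P i ≡ D Q i) × (∀ i j → X P i j ≡ X Q i j)
      × (∀ k i j → Z P k i j ≡ Z Q k i j)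

IsInt : ℚ → Set
IsInt q = ∃[ z ] (q ≡ z / 1)

IntegerPoint : ∀ {n} → Point n → Set
IntegerPoint P = (∀ i → IsInt (D P i)) × (∀ i j → IsInt (X P i j))
               × (∀ k i j → IsInt (Z P k i j))

obj : ∀ {n} → (Fin n → ℚ) → (Fin n → ℚ) → ℚ
obj w d = Σℚ (λ i → w i * d i)

LowerEnvelope : ∀ {n} → Tree n → Point n → Set
LowerEnvelope U P = ∃[ w ] ((∀ i → 0ℚ ≤ w i) × Feasible U P
  × (∀ Q → Feasible U Q → obj w (D P) ≤ obj w (D Q))
  × (∀ Q → Feasible U Q → obj w (D Q) ≡ obj w (D P) → Q ≐ P))

InProjD : ∀ {n} → Tree n → (Fin n → ℚ) → Set
InProjD {n} U d = Σ (Point n) λ Q → Feasible U Q × (∀ i → D Q i ≡ d i)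

LowerEnvelopeD : ∀ {n} → Tree n → (Fin n → ℚ) → Set
LowerEnvelopeD U d = ∃[ w ] ((∀ i → 0ℚ ≤ w i) × InProjD U d
  × (∀ e → InProjD U e → obj w d ≤ obj w e)
  × (∀ e → InProjD U e → obj w e ≡ obj w d → ∀ i → e i ≡ d i))

InducedBy : ∀ {n} → Tree n → RT n → Point n → Set
InducedBy U T P =
    (∀ i j → (Anc T i j → X P i j ≡ 1ℚ) × (¬ Anc T i j → X P i j ≡ 0ℚ))
  × (∀ k i j → ((Between U k i j × IsLCA T k i j) → Z P k i j ≡ 1ℚ)
             × (¬ (Between U k i j × IsLCA T k i j) → Z P k i j ≡ 0ℚ))
  × (∀ i → D P i ≡ Σℚ (λ j → X P j i))

Induced : ∀ {n} → Tree n → Point n → Set₁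
Induced {n} U P = Σ (RT n) λ T → IsSTTOver U T × InducedBy U T P

{-# OPTIONS --safe #-}

-- Let T be an STT and let each weight be w i = 1 + Σ w j over the proper descendants j of i.  For a feasible point, let
-- bad i be the sum of X k i over the non-ancestors k of i.  If i is an ancestor of j, no vertex strictly between i and j
-- is an ancestor of i, so 1 ≤ X i j + bad i.  Summing with the weights, the objective exceeds that of the point of T by at
-- least Σ bad i, which gives optimality and, in the case of equality, uniqueness.
--
-- Conversely, let P be an integer point and S a connected vertex set.  For j in S let R j be the union of the paths from
-- the vertices i of S with i = j or X i j ≥ 1 to j.  These subtrees meet pairwise by the covering constraints, hence by
-- Helly's theorem have a common vertex r.  For j ≠ r some i with X i j ≥ 1 is not in the component of j in S ∖ r, so
-- taking r as the root and recursing yields an STT whose depths are at most the D-coordinates of P.  If P projects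
-- to a vertex on the lower envelope, these depths equal the D-coordinates, and the uniqueness above identifies P with
-- the point of that STT.

module Submission where

open import Defs
open import Data.Nat using (ℕ; suc)
open import Data.Product using (_×_)
open import Data.Nat using (zero; s≤s; z≤n)
import Data.Nat.Coprimality as Coprimality
open import Data.Integer using (ℤ; -[1+_]; ∣_∣; +≤+) renaming (+_ to pos)
open import Data.Rational using (ℚ; 0ℚ; 1ℚ; mkℚ; _/_; *≤*; _≤_; _<_; _+_; _*_; _≤?_; nonNegative; positive)
open import Data.Rational.Properties as ℚP using (≤-refl; ≤-trans; ≤-antisym; ≤-reflexive; +-mono-≤; +-monoʳ-≤; +-identityˡ; +-identityʳ; module ≤-Reasoning)
open import Data.Rational.Solver using (module +-*-Solver)
open import Data.Fin using (Fin; zero; suc; _≟_)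
open import Data.Fin.Properties using (any?; all?)
open import Data.Fin.Induction using (spo-noetherian)
open import Data.Fin.Subset using (Subset; _⊂_) renaming (_∈_ to _∈ₛ_; ⊤ to ⊤ₛ)
open import Data.Fin.Subset.Properties using () renaming (_∈?_ to _∈ₛ?_; ∈⊤ to ∈⊤ₛ)
open import Data.Fin.Subset.Induction using (⊂-wellFounded; Acc; acc)
open import Data.Vec using (tabulate)
open import Data.Vec.Properties using (lookup∘tabulate; []=⇒lookup; lookup⇒[]=)
open import Data.List using (List; []; _∷_; [_]; map; filter; allFin)
open import Data.List.Relation.Unary.All as All using (All; []; _∷_)
import Data.List.Relation.Unary.All.Properties as AllP
open import Data.List.Relation.Unary.Any as Any using (Any; here; there)
import Data.List.Relation.Unary.Any.Properties as AnyP
open import Data.List.Relation.Unary.AllPairs using (AllPairs; []; _∷_)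
import Data.List.Relation.Unary.AllPairs.Properties as AllPairsP
import Data.List.Relation.Unary.Unique.Propositional.Properties as UniqueP
open import Data.List.Membership.Propositional using (_∈_; _∉_; find; lose)
open import Data.List.Membership.Propositional.Properties using (∈-allFin; ∈-filter⁺; ∈-map⁻)
open import Data.Product using (Σ; ∃; ∃-syntax; _,_; proj₁; proj₂; swap)
open import Data.Sum using (_⊎_; inj₁; inj₂)
open import Data.Empty using (⊥; ⊥-elim)
open import Data.Unit using (tt)
open import Function using (_∘_; id; flip; case_of_)
import Induction.WellFounded as WF
open import Level using (0ℓ)
open import Relation.Nullary using (¬_; Dec; yes; no; does)
open import Relation.Nullary.Decidable using (map′; _×-dec_; _⊎-dec_; _→-dec_; ¬?; dec-true)
open import Relation.Unary using (Decidable)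
open import Relation.Binary.PropositionalEquality using (_≡_; _≢_; refl; sym; trans; cong; cong₂; subst; isEquivalence; resp₂; module ≡-Reasoning)

-- Finite sums of rationals

private
  variable
    n : ℕ
    A : Set

+-cancelˡ-≤ : ∀ r {p q} → r + p ≤ r + q → p ≤ q
+-cancelˡ-≤ r {p} {q} h = ℚP.≮⇒≥ λ q<p → ℚP.<-irrefl refl (ℚP.<-≤-trans (ℚP.+-monoʳ-< r q<p) h)

*-monoˡ-≤ : ∀ {r p q} → 0ℚ ≤ r → p ≤ q → r * p ≤ r * q
*-monoˡ-≤ {r} 0≤r = ℚP.*-monoˡ-≤-nonNeg r {{nonNegative 0≤r}}

0≤1 : 0ℚ ≤ 1ℚ
0≤1 = ℚP.nonNegative⁻¹ 1ℚ

1≰0 : ¬ 1ℚ ≤ 0ℚ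
1≰0 h with ≤-antisym 0≤1 h
... | ()

Σ-cong : {f g : Fin n → ℚ} → (∀ i → f i ≡ g i) → Σℚ f ≡ Σℚ g
Σ-cong {zero}  h = refl
Σ-cong {suc n} h = cong₂ _+_ (h zero) (Σ-cong (λ i → h (suc i)))

Σ-mono : {f g : Fin n → ℚ} → (∀ i → f i ≤ g i) → Σℚ f ≤ Σℚ g
Σ-mono {zero}  h = ≤-refl
Σ-mono {suc n} h = +-mono-≤ (h zero) (Σ-mono (λ i → h (suc i)))

Σ-zero : {f : Fin n → ℚ} → (∀ i → f i ≡ 0ℚ) → Σℚ f ≡ 0ℚ
Σ-zero {zero}  h = refl
Σ-zero {suc n} h = cong₂ _+_ (h zero) (Σ-zero (λ i → h (suc i)))

Σ-nonNeg : {f : Fin n → ℚ} → (∀ i → 0ℚ ≤ f i) → 0ℚ ≤ Σℚ f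
Σ-nonNeg {n} h = ≤-trans (≤-reflexive (sym (Σ-zero {n} (λ _ → refl)))) (Σ-mono h)

Σ-distrib-+ : (f g : Fin n → ℚ) → Σℚ (λ i → f i + g i) ≡ Σℚ f + Σℚ g
Σ-distrib-+ {zero}  f g = refl
Σ-distrib-+ {suc n} f g = trans
    (cong ((f zero + g zero) +_) (Σ-distrib-+ (λ i → f (suc i)) (λ i → g (suc i))))
    (interchange (f zero) (g zero) (Σℚ λ i → f (suc i)) (Σℚ λ i → g (suc i)))
  where
  open +-*-Solver
  interchange : ∀ a b c d → (a + b) + (c + d) ≡ (a + c) + (b + d)
  interchange = solve 4 (λ a b c d → (a :+ b) :+ (c :+ d) := (a :+ c) :+ (b :+ d)) refl

Σ-distrib-* : (c : ℚ) (f : Fin n → ℚ) → c * Σℚ f ≡ Σℚ (λ i → c * f i)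
Σ-distrib-* {zero}  c f = ℚP.*-zeroʳ c
Σ-distrib-* {suc n} c f = trans (ℚP.*-distribˡ-+ c (f zero) (Σℚ λ i → f (suc i)))
  (cong (c * f zero +_) (Σ-distrib-* c (λ i → f (suc i))))

Σ-swap : ∀ {m n} (f : Fin m → Fin n → ℚ) → Σℚ (λ i → Σℚ (f i)) ≡ Σℚ (λ j → Σℚ (λ i → f i j))
Σ-swap {zero} {n} f = sym (Σ-zero {n} (λ _ → refl))
Σ-swap {suc m} f = trans (cong (Σℚ (f zero) +_) (Σ-swap (λ i → f (suc i))))
  (sym (Σ-distrib-+ (f zero) (λ j → Σℚ (λ i → f (suc i) j))))

term≤Σ : {f : Fin n → ℚ} → (∀ i → 0ℚ ≤ f i) → ∀ i → f i ≤ Σℚ f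
term≤Σ {suc n} {f} h zero =
  ≤-trans (≤-reflexive (sym (+-identityʳ (f zero)))) (+-monoʳ-≤ (f zero) (Σ-nonNeg (λ i → h (suc i))))
term≤Σ {suc n} {f} h (suc i) =
  ≤-trans (term≤Σ (λ i → h (suc i)) i)
    (≤-trans (≤-reflexive (sym (+-identityˡ rest))) (ℚP.+-monoˡ-≤ rest (h zero)))
  where
  rest = Σℚ (λ i → f (suc i))

-- One strict coordinate would make the sums strictly ordered. The equality cases for `bad`, D and X
-- below all rest on this.
Σ-mono-tight : {f g : Fin n → ℚ} → (∀ i → f i ≤ g i) → Σℚ g ≤ Σℚ f → ∀ i → g i ≡ f i
Σ-mono-tight {suc n} {f} {g} h le zero = ≤-antisym (ℚP.≮⇒≥ strict) (h zero)
  where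
  strict : ¬ f zero < g zero
  strict lt = ℚP.<-irrefl refl (ℚP.<-≤-trans (ℚP.+-mono-<-≤ lt (Σ-mono (λ i → h (suc i)))) le)
Σ-mono-tight {suc n} {f} {g} h le (suc i) =
  Σ-mono-tight (λ i → h (suc i))
    (+-cancelˡ-≤ (g zero) (≤-trans le (ℚP.+-monoˡ-≤ _ (h zero)))) i

-- Sums over a decidable subset are written as sums over all of `Fin n` with masked terms, so that
-- sums over different subsets compare term by term.
mask : Dec A → ℚ → ℚ
mask (yes _) q = q
mask (no  _) q = 0ℚ

ind : Dec A → ℚ
ind d = mask d 1ℚ

mask-yes : (d : Dec A) (q : ℚ) → A → mask d q ≡ q
mask-yes (yes _) q _ = refl
mask-yes (no ¬a) q a = ⊥-elim (¬a a)

mask-no : (d : Dec A) (q : ℚ) → ¬ A → mask d q ≡ 0ℚ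
mask-no (yes a) q ¬a = ⊥-elim (¬a a)
mask-no (no _)  q _  = refl

mask-nonNeg : (d : Dec A) {q : ℚ} → 0ℚ ≤ q → 0ℚ ≤ mask d q
mask-nonNeg (yes _) h = h
mask-nonNeg (no _)  h = ≤-refl

mask-≤ : (d : Dec A) {q : ℚ} → 0ℚ ≤ q → mask d q ≤ q
mask-≤ (yes _) h = ≤-refl
mask-≤ (no _)  h = h

Σ-mask-≡ : (k : Fin n) (q : ℚ) → Σℚ (λ i → mask (i ≟ k) q) ≡ q
Σ-mask-≡ {suc n} zero q = trans (cong (q +_) (Σ-zero {n} λ i → refl)) (+-identityʳ q)
Σ-mask-≡ {suc n} (suc k) q = trans (+-identityˡ _) (trans (Σ-cong same) (Σ-mask-≡ k q))
  where
  same : ∀ i → mask (suc i ≟ suc k) q ≡ mask (i ≟ k) q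
  same i with i ≟ k
  ... | yes _ = refl
  ... | no _  = refl

-- Paths and the Helly property in a tree

module Segments {n : ℕ} (U : Tree n) where

  V : Set
  V = Fin n

  open import Data.List.Membership.DecPropositional (_≟_ {n}) using (_∈?_) public

  source∈ : ∀ {i j p} → Walk (Adj U) i j p → i ∈ p
  source∈ stop       = here refl
  source∈ (step _ _) = here refl

  path-suffix : ∀ {i j p x} → IsPath (Adj U) i j p → x ∈ p →
                ∃[ q ] (IsPath (Adj U) x j q × (∀ {z} → z ∈ q → z ∈ p))
  path-suffix {p = p} π@(stop , _)     (here refl) = p , π , id
  path-suffix {p = p} π@(step _ _ , _) (here refl) = p , π , id
  path-suffix (step _ w , _ ∷ u) (there x∈) with path-suffix (w , u) x∈
  ... | q , π , q⊆ = q , π , there ∘ q⊆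

  loop-erase : ∀ {i j p} → Walk (Adj U) i j p →
               ∃[ q ] (IsPath (Adj U) i j q × (∀ {z} → z ∈ q → z ∈ p))
  loop-erase stop = _ , (stop , [] ∷ []) , id
  loop-erase {i} (step a w) with loop-erase w
  ... | q , (w′ , u) , q⊆ with i ∈? q
  ...   | yes i∈ = let q′ , π , q′⊆ = path-suffix (w′ , u) i∈ in q′ , π , there ∘ q⊆ ∘ q′⊆
  ...   | no  i∉ = i ∷ q , (step a w′ , AllP.¬Any⇒All¬ q i∉ ∷ u) , λ { (here e) → here e ; (there z∈) → there (q⊆ z∈) }

  seg : V → V → List V
  seg i j = proj₁ (uniquePath U i j)

  seg-path : ∀ i j → IsPath (Adj U) i j (seg i j)
  seg-path i j = proj₁ (proj₂ (uniquePath U i j))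

  seg-unique : ∀ {i j p} → IsPath (Adj U) i j p → p ≡ seg i j
  seg-unique {i} {j} = proj₂ (proj₂ (uniquePath U i j)) _

  -- Walks rather than paths, since walks concatenate without having to stay free of repetitions;
  -- `linked⇒seg` returns to the path.
  Linked : (V → Set) → V → V → Set
  Linked S i j = ∃[ p ] (Walk (Adj U) i j p × All S p)

  module _ {S : V → Set} where

    linked-refl : ∀ {i} → S i → Linked S i i
    linked-refl s = _ , stop , s ∷ []

    linked-step : ∀ {i k j} → S i → Adj U i k → Linked S k j → Linked S i j
    linked-step s a (_ , w , ss) = _ , step a w , s ∷ ss

    linked-trans : ∀ {i j k} → Linked S i j → Linked S j k → Linked S i k
    linked-trans (_ , stop , _) l = l
    linked-trans (_ , step a w , s ∷ ss) l = linked-step s a (linked-trans (_ , w , ss) l)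

    linked-sym : ∀ {i j} → Linked S i j → Linked S j i
    linked-sym (_ , stop , s ∷ []) = linked-refl s
    linked-sym (_ , step a w , s ∷ ss) =
      linked-trans (linked-sym (_ , w , ss))
        (linked-step (All.lookup ss (source∈ w)) (Adj-sym U a) (linked-refl s))

    linked-target : ∀ {i j} → Linked S i j → S j
    linked-target (_ , stop , s ∷ [])     = s
    linked-target (_ , step _ w , _ ∷ ss) = linked-target (_ , w , ss)

    linked-suffix : ∀ {i j p x} → Walk (Adj U) i j p → All S p → x ∈ p → Linked S x j
    linked-suffix stop ss (here refl) = _ , stop , ss
    linked-suffix (step a w) ss (here refl) = _ , step a w , ss
    linked-suffix (step a w) (_ ∷ ss) (there x∈) = linked-suffix w ss x∈

    linked-within : ∀ {i j} → Linked S i j → Linked (Linked S i) i j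
    linked-within {i} l@(p , w , ss) = p , w , All.tabulate λ x∈ →
      linked-trans l (linked-sym (linked-suffix w ss x∈))

    -- Erasing loops only removes vertices and ends in the unique path, so every walk from i to j
    -- visits all of `seg i j`. Most facts on segments apply this to a suitable S.
    linked⇒seg : ∀ {i j} → Linked S i j → ∀ {z} → z ∈ seg i j → S z
    linked⇒seg (_ , w , ss) z∈ with loop-erase w
    ... | q , π , q⊆ = All.lookup ss (q⊆ (subst (_ ∈_) (sym (seg-unique π)) z∈))

    seg⇒linked : ∀ {i j} → (∀ {z} → z ∈ seg i j → S z) → Linked S i j
    seg⇒linked h = _ , proj₁ (seg-path _ _) , All.tabulate h

    -- Being linked in S amounts to `seg i j` lying in S, which is a test on one finite list.
    linked? : Decidable S → ∀ i j → Dec (Linked S i j)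
    linked? S? i j = map′ (λ ss → seg⇒linked (All.lookup ss)) (λ l → All.tabulate (linked⇒seg l))
                          (All.all? S? (seg i j))

  linked-map : ∀ {S S′ : V → Set} → (∀ {z} → S z → S′ z) → ∀ {i j} → Linked S i j → Linked S′ i j
  linked-map f (p , w , ss) = p , w , All.map f ss

  seg-linked : ∀ i j → Linked (_∈ seg i j) i j
  seg-linked i j = seg⇒linked id

  source∈seg : ∀ i j → i ∈ seg i j
  source∈seg i j = source∈ (proj₁ (seg-path i j))

  seg-sym : ∀ {i j z} → z ∈ seg i j → z ∈ seg j i
  seg-sym {i} {j} = linked⇒seg (linked-sym (seg-linked j i))

  seg-suffix : ∀ {i j x z} → x ∈ seg i j → z ∈ seg x j → z ∈ seg i j
  seg-suffix {i} {j} x∈ =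
    linked⇒seg (linked-suffix (proj₁ (seg-path i j)) (All.tabulate id) x∈)

  -- The walk from i through j to k contains the path from i to k.
  seg-triangle : ∀ {i j k z} → z ∈ seg i k → z ∈ seg i j ⊎ z ∈ seg j k
  seg-triangle {i} {j} {k} = linked⇒seg
    (linked-trans (linked-map inj₁ (seg-linked i j)) (linked-map inj₂ (seg-linked j k)))

  seg-refl : ∀ {i z} → z ∈ seg i i → z ≡ i
  seg-refl {i} = linked⇒seg {S = _≡ i} (linked-refl refl)

  next∈seg : ∀ {i k j} → Adj U i k → i ∉ seg k j → k ∈ seg i j
  next∈seg {i} {k} {j} a i∉ = subst (k ∈_)
    (seg-unique (step a (proj₁ (seg-path k j)) , AllP.¬Any⇒All¬ _ i∉ ∷ proj₂ (seg-path k j)))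
    (there (source∈seg k j))

  -- `Tree` carries no decision for `Adj`, so it is read off `seg i j`: for adjacent i and j the
  -- single edge is a path, hence the only one.
  adj? : ∀ i j → Dec (Adj U i j)
  adj? i j with i ≟ j
  ... | yes refl = no (Adj-irr U)
  ... | no i≢j with seg i j | seg-path i j | (λ {p} → seg-unique {i} {j} {p})
  ...   | _ | stop , _ | _ = ⊥-elim (i≢j refl)
  ...   | _ | step a stop , _ | _ = yes a
  ...   | _ | step _ (step _ w) , _ | uniq = no λ a → two≢ w (uniq (step a stop , (i≢j ∷ []) ∷ [] ∷ []))
    where
    two≢ : ∀ {x y p} {a b c : V} → Walk (Adj U) x y p → _≢_ {A = List V} (a ∷ [ b ]) (a ∷ c ∷ p)
    two≢ stop ()
    two≢ (step _ _) ()

  Inner : V → V → V → Set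
  Inner k i j = k ∈ seg i j × k ≢ i × k ≢ j

  between⇒inner : ∀ {k i j} → Between U k i j → Inner k i j
  between⇒inner (p , π , k∈ , ne) = subst (_ ∈_) (seg-unique π) k∈ , ne

  inner⇒between : ∀ {k i j} → Inner k i j → Between U k i j
  inner⇒between (k∈ , ne) = _ , seg-path _ _ , k∈ , ne

  between? : ∀ k i j → Dec (Between U k i j)
  between? k i j = map′ inner⇒between between⇒inner (k ∈? seg i j ×-dec (¬? (k ≟ i) ×-dec ¬? (k ≟ j)))

  between-sym : ∀ {k i j} → Between U k i j → Between U k j i
  between-sym b = let k∈ , k≢i , k≢j = between⇒inner b in inner⇒between (seg-sym k∈ , k≢j , k≢i)

  Convex : (V → Set) → Set
  Convex A = ∀ {x y z} → A x → A y → z ∈ seg x y → A z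

  -- The paths from x and y to the centre c cover the path from x to y. This suits the sets
  -- `Reach S j`, which are unions of paths ending at j.
  starShaped⇒convex : ∀ {A c} → (∀ {x z} → A x → z ∈ seg x c → A z) → Convex A
  starShaped⇒convex star ax ay z∈ with seg-triangle z∈
  ... | inj₁ z∈xc = star ax z∈xc
  ... | inj₂ z∈cy = star ay (seg-sym z∈cy)

  -- If a ∉ A then a lies on neither [k,b] nor [b,c], hence not on [k,c]; so the next vertex k lies on [a,c] ⊆ B.
  helly₂ : ∀ {A B a b c p} → Decidable A → Convex A → Convex B →
           IsPath (Adj U) a b p → B a → A b → A c → B c → ∃[ x ] (x ∈ p × A x × B x)
  helly₂ A? cA cB (stop , _) ba ab _ _ = _ , here refl , ab , ba
  helly₂ {A} {B} {a} {b} {c} A? cA cB (step {k = k} adj w , a∉ ∷ u) ba ab ac bc with A? a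
  ... | yes aa = a , here refl , aa , ba
  ... | no ¬aa =
    let x , x∈ , ax , bx = helly₂ A? cA cB (w , u) (cB ba bc (next∈seg adj a∉kc)) ab ac bc
    in x , there x∈ , ax , bx
    where
    a∉kc : a ∉ seg k c
    a∉kc a∈ with seg-triangle a∈
    ... | inj₁ a∈kb = AllP.All¬⇒¬Any a∉ (subst (a ∈_) (sym (seg-unique (w , u))) a∈kb)
    ... | inj₂ a∈bc = ¬aa (cA ab ac a∈bc)

  -- `helly₂` finds the common vertex of A and B on the path from a to b; both ends of that path are
  -- in C, so convexity puts the vertex in C too.
  helly₃ : ∀ {A B C a b c} → Decidable A → Convex A → Convex B → Convex C →
           B a → C a → A b → C b → A c → B c → ∃[ x ] (A x × B x × C x)
  helly₃ {a = a} {b} A? cA cB cC ba ca ab cb ac bc =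
    let x , x∈ , ax , bx = helly₂ A? cA cB (seg-path a b) ba ab ac bc
    in x , ax , bx , cC ca cb x∈

  -- Induction on the list, with the accumulator A intersected with each `G i` in turn. The case of
  -- three sets shows that the smaller accumulator still meets the sets to come.
  helly : {I : Set} {Q : I → Set} {G : I → V → Set} → (∀ i → Decidable (G i)) → (∀ i → Convex (G i)) →
          (∀ {i j} → Q i → Q j → ∃[ x ] (G i x × G j x)) →
          ∀ {A is} → Decidable A → Convex A → ∃ A → (∀ {i} → Q i → ∃[ x ] (A x × G i x)) →
          All Q is → ∃[ x ] (A x × All (λ i → G i x) is)
  helly G? cG meet A? cA (x , ax) meetA [] = x , ax , []
  helly {G = G} G? cG meet {A} A? cA _ meetA (_∷_ {x = i} q qs) =
    let x , (ax , gx) , all = helly G? cG meet (λ x → A? x ×-dec G? i x)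
          (λ (ax , gx) (ay , gy) z∈ → cA ax ay z∈ , cG i gx gy z∈) (meetA q) meet′ qs
    in x , ax , gx ∷ all
    where
    meet′ : ∀ {j} → _ → ∃[ x ] ((A x × G i x) × G j x)
    meet′ {j} q′ =
      let a , ga , g′a = meet q q′
          b , ab , g′b = meetA q′
          c , ac , gc = meetA q
          x , ax , gx , g′x = helly₃ A? cA (cG i) (cG j) ga g′a ab g′b ac gc
      in x , (ax , gx) , g′x

-- Ancestors in search trees

module _ {n : ℕ} where

  mutual
    _∈T?_ : ∀ x (t : RT n) → Dec (x ∈T t)
    x ∈T? node r ts with x ≟ r
    ... | yes refl = yes here
    ... | no x≢r = map′ there (λ { here → ⊥-elim (x≢r refl) ; (there a) → a }) (x ∈Ts? ts)

    _∈Ts?_ : ∀ x (ts : List (RT n)) → Dec (Any (x ∈T_) ts)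
    x ∈Ts? [] = no λ ()
    x ∈Ts? (t ∷ ts) = map′ Any.fromSum Any.toSum ((x ∈T? t) ⊎-dec (x ∈Ts? ts))

  mutual
    anc? : ∀ t (i j : Fin n) → Dec (Anc t i j)
    anc? (node r ts) i j with i ≟ r | j ∈Ts? ts | ancs? ts i j
    ... | yes refl | yes j∈ | _      = yes (root j∈)
    ... | _        | _      | yes a  = yes (deeper a)
    ... | no i≢r   | _      | no ¬a  = no λ { (root _) → i≢r refl ; (deeper a) → ¬a a }
    ... | yes refl | no j∉  | no ¬a  = no λ { (root j∈) → j∉ j∈ ; (deeper a) → ¬a a }

    ancs? : ∀ ts (i j : Fin n) → Dec (Any (λ t → Anc t i j) ts)
    ancs? [] i j = no λ ()
    ancs? (t ∷ ts) i j = map′ Any.fromSum Any.toSum (anc? t i j ⊎-dec ancs? ts i j)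

  mutual
    anc-source : ∀ {t} {i j : Fin n} → Anc t i j → i ∈T t
    anc-source (root _)   = here
    anc-source (deeper a) = there (anc-sources a)

    anc-sources : ∀ {ts} {i j : Fin n} → Any (λ t → Anc t i j) ts → Any (i ∈T_) ts
    anc-sources (here a)  = here (anc-source a)
    anc-sources (there a) = there (anc-sources a)

  mutual
    anc-target : ∀ {t} {i j : Fin n} → Anc t i j → j ∈T t
    anc-target (root a)   = there a
    anc-target (deeper a) = there (anc-targets a)

    anc-targets : ∀ {ts} {i j : Fin n} → Any (λ t → Anc t i j) ts → Any (j ∈T_) ts
    anc-targets (here a)  = here (anc-target a)
    anc-targets (there a) = there (anc-targets a)

  DisjointT : RT n → RT n → Set
  DisjointT t t′ = ∀ x → x ∈T t → x ∈T t′ → ⊥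

  same-subtree : ∀ {ts t t′ x} → AllPairs DisjointT ts → t ∈ ts → t′ ∈ ts → x ∈T t → x ∈T t′ → t ≡ t′
  same-subtree (_ ∷ _) (here refl) (here refl) _ _ = refl
  same-subtree (d ∷ _) (here refl) (there t′∈) x∈ x∈′ = ⊥-elim (All.lookup d t′∈ _ x∈ x∈′)
  same-subtree (d ∷ _) (there t∈) (here refl) x∈ x∈′ = ⊥-elim (All.lookup d t∈ _ x∈′ x∈)
  same-subtree (_ ∷ ds) (there t∈) (there t′∈) x∈ x∈′ = same-subtree ds t∈ t′∈ x∈ x∈′

  ancEq-target : ∀ {t} {i j : Fin n} → AncEq t i j → j ∈T t
  ancEq-target (inj₁ (_ , j∈)) = j∈
  ancEq-target (inj₂ a)        = anc-target a

  -- Only these two properties of the child list are assumed, because the module serves both for a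
  -- given STT and for the tree under construction in `Step`.
  module Children {r : Fin n} {ts} (r∉ : ∀ {t} → t ∈ ts → ¬ r ∈T t) (dis : AllPairs DisjointT ts) where

    ascend : ∀ {t i j} → t ∈ ts → Anc t i j → Anc (node r ts) i j
    ascend t∈ a = deeper (lose t∈ a)

    below-root : ∀ {i} → Anc (node r ts) r i → ∃[ t ] (t ∈ ts × i ∈T t)
    below-root (root a)   = find a
    below-root (deeper a) = let t , t∈ , a′ = find a in t , t∈ , anc-target a′

    descend : ∀ {t i j} → t ∈ ts → i ∈T t → Anc (node r ts) i j → Anc t i j
    descend t∈ i∈ (root _) = ⊥-elim (r∉ t∈ i∈)
    descend t∈ i∈ (deeper a) with find a
    ... | t′ , t′∈ , a′ with same-subtree dis t∈ t′∈ i∈ (anc-source a′)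
    ...   | refl = a′

    descend-target : ∀ {t i j} → t ∈ ts → j ∈T t → Anc (node r ts) i j → i ≡ r ⊎ Anc t i j
    descend-target t∈ j∈ (root _) = inj₁ refl
    descend-target t∈ j∈ (deeper a) with find a
    ... | t′ , t′∈ , a′ with same-subtree dis t∈ t′∈ j∈ (anc-target a′)
    ...   | refl = inj₂ a′

    no-anc-of-root : ∀ {i} → ¬ Anc (node r ts) i r
    no-anc-of-root (root a)   = let _ , t∈ , r∈ = find a in r∉ t∈ r∈
    no-anc-of-root (deeper a) = let _ , t∈ , a′ = find a in r∉ t∈ (anc-target a′)

    descend-eq : ∀ {t i j} → t ∈ ts → i ∈T t → AncEq (node r ts) i j → AncEq t i j
    descend-eq t∈ i∈ (inj₁ (refl , _)) = inj₁ (refl , i∈)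
    descend-eq t∈ i∈ (inj₂ a)          = inj₂ (descend t∈ i∈ a)

module STT {n : ℕ} (U : Tree n) where

  open Segments U

  SubSTT : (V → Set) → V → RT n → Set₁
  SubSTT S r t = IsComponent U (λ x → S x × x ≢ r) (_∈T t) × IsSTT U (_∈T t) t

  -- Recursing through `go` keeps the induction structural, while the algebra may reach each child
  -- by its membership in `ts`.
  stt-ind : ∀ (P : (V → Set) → RT n → Set) →
    (∀ {S r ts} → S r → (∀ {t} → t ∈ ts → SubSTT S r t × P (_∈T t) t) →
      (∀ x → S x → x ≢ r → Any (x ∈T_) ts) → AllPairs DisjointT ts → P S (node r ts)) →
    ∀ {S T} → IsSTT U S T → P S T
  stt-ind P alg (mk {S} {r} sr all cover dis) = alg sr (λ t∈ → All.lookup (go all) t∈) cover dis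
    where
    go : ∀ {ts} → All (SubSTT S r) ts → All (λ t → SubSTT S r t × P (_∈T t) t) ts
    go [] = []
    go ((c , s) ∷ ss) = ((c , s) , stt-ind P alg s) ∷ go ss

  -- The first three laws make T a forest order. The last two tie it to U: `split` yields the
  -- covering constraints, and `separates` locates lowest common ancestors and drives the optimality
  -- argument.
  record AncestorLaws (T : RT n) : Set where
    field
      irrefl     : ∀ {i} → ¬ Anc T i i
      transitive : ∀ {i j k} → Anc T i j → Anc T j k → Anc T i k
      chain      : ∀ {i j k} → Anc T i k → Anc T j k → i ≡ j ⊎ Anc T i j ⊎ Anc T j i
      split      : ∀ {i j} → i ∈T T → j ∈T T → i ≢ j →
                   Anc T i j ⊎ Anc T j i ⊎ ∃[ k ] (k ∈ seg i j × Anc T k i × Anc T k j)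
      separates  : ∀ {k i j m} → k ∈ seg i j → Anc T k m → AncEq T m i → AncEq T m j → ⊥

  -- Connectivity of S travels with the induction, since `split` needs paths between nodes to stay
  -- in S. Each child inherits it, because a walk in S that avoids r cannot leave its component.
  stt-laws : ∀ {S T} → IsSTT U S T → (∀ {x y} → S x → S y → Linked S x y) → AncestorLaws T
  stt-laws s = stt-ind (λ S T → (∀ {x y} → S x → S y → Linked S x y) → AncestorLaws T) alg s
    where
    alg : ∀ {S r ts} → S r →
      (∀ {t} → t ∈ ts → SubSTT S r t × ((∀ {x y} → x ∈T t → y ∈T t → Linked (_∈T t) x y) → AncestorLaws t)) →
      (∀ x → S x → x ≢ r → Any (x ∈T_) ts) → AllPairs DisjointT ts →
      (∀ {x y} → S x → S y → Linked S x y) → AncestorLaws (node r ts)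
    alg {S} {r} {ts} sr sub cover dis conn = record
      { irrefl = irrefl′ ; transitive = trans′ ; chain = chain′ ; split = split′ ; separates = separates′ }
      where
      T = node r ts

      comp : ∀ {t} → t ∈ ts → IsComponent U (λ x → S x × x ≢ r) (_∈T t)
      comp t∈ = proj₁ (proj₁ (sub t∈))

      stays : ∀ {t} → t ∈ ts → ∀ {x y} → x ∈T t → Linked (λ z → S z × z ≢ r) x y → Linked (_∈T t) x y
      stays t∈ x∈ (_ , stop , _) = linked-refl x∈
      stays t∈ x∈ (_ , step a w , _ ∷ ss) =
        linked-step x∈ a (stays t∈ (proj₂ (proj₂ (comp t∈)) _ _ x∈ (All.lookup ss (source∈ w)) a) (_ , w , ss))

      laws : ∀ {t} → t ∈ ts → AncestorLaws t
      laws t∈ = proj₂ (sub t∈) λ x∈ y∈ → stays t∈ x∈ (proj₁ (proj₂ (comp t∈)) _ _ x∈ y∈)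

      r∉ : ∀ {t} → t ∈ ts → ¬ r ∈T t
      r∉ t∈ r∈ = proj₂ (proj₁ (comp t∈) _ r∈) refl

      open Children r∉ dis

      irrefl′ : ∀ {i} → ¬ Anc T i i
      irrefl′ a@(root _) = no-anc-of-root a
      irrefl′ (deeper a) = let _ , t∈ , a′ = find a in AncestorLaws.irrefl (laws t∈) a′

      trans′ : ∀ {i j k} → Anc T i j → Anc T j k → Anc T i k
      trans′ (root a) b = let t , t∈ , j∈ = find a in root (lose t∈ (anc-target (descend t∈ j∈ b)))
      trans′ (deeper a) b =
        let t , t∈ , a′ = find a
        in ascend t∈ (AncestorLaws.transitive (laws t∈) a′ (descend t∈ (anc-target a′) b))

      chain′ : ∀ {i j k} → Anc T i k → Anc T j k → i ≡ j ⊎ Anc T i j ⊎ Anc T j i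
      chain′ (root _) (root _) = inj₁ refl
      chain′ (root _) (deeper b) = inj₂ (inj₁ (root (anc-sources b)))
      chain′ (deeper a) b with find a
      ... | t , t∈ , a′ with descend-target t∈ (anc-target a′) b
      ...   | inj₁ refl = inj₂ (inj₂ (root (anc-sources a)))
      ...   | inj₂ b′ with AncestorLaws.chain (laws t∈) a′ b′
      ...     | inj₁ e        = inj₁ e
      ...     | inj₂ (inj₁ c) = inj₂ (inj₁ (ascend t∈ c))
      ...     | inj₂ (inj₂ c) = inj₂ (inj₂ (ascend t∈ c))

      split′ : ∀ {i j} → i ∈T T → j ∈T T → i ≢ j →
               Anc T i j ⊎ Anc T j i ⊎ ∃[ k ] (k ∈ seg i j × Anc T k i × Anc T k j)
      split′ here here i≢j = ⊥-elim (i≢j refl)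
      split′ here (there j∈) _ = inj₁ (root j∈)
      split′ (there i∈) here _ = inj₂ (inj₁ (root i∈))
      split′ {i} {j} (there i∈s) (there j∈s) i≢j with find i∈s
      ... | t , t∈ , i∈ with j ∈T? t
      ...   | yes j∈ with AncestorLaws.split (laws t∈) i∈ j∈ i≢j
      ...     | inj₁ a                        = inj₁ (ascend t∈ a)
      ...     | inj₂ (inj₁ a)                 = inj₂ (inj₁ (ascend t∈ a))
      ...     | inj₂ (inj₂ (k , k∈ , a , b)) = inj₂ (inj₂ (k , k∈ , ascend t∈ a , ascend t∈ b))
      split′ {i} {j} (there i∈s) (there j∈s) i≢j | t , t∈ , i∈ | no j∉ =
        inj₂ (inj₂ (r , r∈seg , root i∈s , root j∈s))
        where
        Sᵢ : S i
        Sᵢ = proj₁ (proj₁ (comp t∈) i i∈)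
        Sⱼ : S j
        Sⱼ = let _ , t′∈ , j∈ = find j∈s in proj₁ (proj₁ (comp t′∈) j j∈)
        r∈seg : r ∈ seg i j
        r∈seg with r ∈? seg i j
        ... | yes r∈ = r∈
        -- A path missing r would stay in the child of i, which does not contain j.
        ... | no r∉ᵢⱼ = ⊥-elim (j∉ (linked-target (stays t∈ i∈ (seg⇒linked λ z∈ →
                linked⇒seg (conn Sᵢ Sⱼ) z∈ , λ { refl → r∉ᵢⱼ z∈ }))))

      separates′ : ∀ {k i j m} → k ∈ seg i j → Anc T k m → AncEq T m i → AncEq T m j → ⊥
      separates′ k∈ (root a) mi mj with find a
      -- Here k = r: both i and j lie in the child of m, so their path avoids r.
      ... | t , t∈ , m∈ = proj₂ (linked⇒seg (proj₁ (proj₂ (comp t∈)) _ _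
              (ancEq-target (descend-eq t∈ m∈ mi)) (ancEq-target (descend-eq t∈ m∈ mj))) k∈) refl
      separates′ k∈ (deeper a) mi mj with find a
      ... | t , t∈ , a′ = AncestorLaws.separates (laws t∈) k∈ a′
              (descend-eq t∈ (anc-target a′) mi) (descend-eq t∈ (anc-target a′) mj)

  stt-nodes : ∀ {S T} → IsSTT U S T → ∀ x → S x → x ∈T T
  stt-nodes (mk {r = r} _ _ cover _) x s with x ≟ r
  ... | yes refl = here
  ... | no x≢r   = there (cover x s x≢r)

  -- Equivalent predicates need not be equal, so a new description of the node set has to be
  -- transported by hand.
  stt-resp : ∀ {S S′ T} → (∀ {x} → S x → S′ x) → (∀ {x} → S′ x → S x) → IsSTT U S T → IsSTT U S′ T
  stt-resp to from (mk sr subs cover dis) =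
    mk (to sr) (All.map (λ ((sub , conn , clos) , s) →
          ((λ x x∈ → let sx , ne = sub x x∈ in to sx , ne)
          , (λ x y x∈ y∈ → linked-map (λ (s , ne) → to s , ne) (conn x y x∈ y∈))
          , (λ x y x∈ (s′ , ne) → clos x y x∈ (from s′ , ne))) , s) subs)
       (λ x s′ → cover x (from s′)) dis

-- An STT dominated by an integer point

-- Components are turned into a `Subset` because the construction of the tree recurses on strict
-- inclusion of such subsets.
comprehension : ∀ {n} {P : Fin n → Set} → Decidable P → Subset n
comprehension P? = tabulate (does ∘ P?)

module _ {n} {P : Fin n → Set} (P? : Decidable P) where

  ∈-comprehension⁺ : ∀ {x} → P x → x ∈ₛ comprehension P?
  ∈-comprehension⁺ {x} p = lookup⇒[]= x _ (trans (lookup∘tabulate _ x) (dec-true (P? x) p))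

  ∈-comprehension⁻ : ∀ {x} → x ∈ₛ comprehension P? → P x
  ∈-comprehension⁻ {x} x∈ with P? x | trans (sym (lookup∘tabulate (does ∘ P?) x)) ([]=⇒lookup x∈)
  ... | yes p | _ = p
  ... | no _  | ()

-- Gathers the trees found for the c in Q into one total function that can be mapped over a list;
-- the default a stands where Q fails.
choose : ∀ {n} {A : Set} {Q : Fin n → Set} {R : Fin n → A → Set₁} → A → Decidable Q →
         (∀ c → Q c → Σ A (R c)) → Σ (Fin n → A) λ f → ∀ c → Q c → R c (f c)
choose {A = A} {Q} {R} a Q? h = (λ c → pick (Q? c)) , λ c q → picked (Q? c) q
  where
  pick : ∀ {c} → Dec (Q c) → A
  pick (yes q) = proj₁ (h _ q)
  pick (no _)  = a
  picked : ∀ {c} (d : Dec (Q c)) → Q c → R c (pick d)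
  picked (yes q) _ = proj₂ (h _ q)
  picked (no ¬q) q = ⊥-elim (¬q q)

allPairs-strengthen : ∀ {A : Set} {Q : A → Set} {R R′ : A → A → Set} →
  (∀ {x y} → Q x → Q y → R x y → R′ x y) → ∀ {xs} → All Q xs → AllPairs R xs → AllPairs R′ xs
allPairs-strengthen f [] [] = []
allPairs-strengthen f (q ∷ qs) (rs ∷ rss) =
  All.zipWith (λ (q′ , r) → f q q′ r) (qs , rs) ∷ allPairs-strengthen f qs rss

-- The inductive step of the depth bound: passing from a child on C to the tree on S adds one
-- ancestor, r, and the term of k, which lies in S but not in C, pays for it.
Σ-mask-step : ∀ {n} {A A′ S C : Fin n → Set} (A? : Decidable A) (A′? : Decidable A′)
  (S? : Decidable S) (C? : Decidable C) {y : Fin n → ℚ} {r k : Fin n} → (∀ i → 0ℚ ≤ y i) →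
  (∀ {i} → A i → i ≡ r ⊎ A′ i) → (∀ {i} → C i → S i) → S k → ¬ C k → 1ℚ ≤ y k →
  Σℚ (λ i → ind (A′? i)) ≤ Σℚ (λ i → mask (C? i) (y i)) →
  Σℚ (λ i → ind (A? i)) ≤ Σℚ (λ i → mask (S? i) (y i))
Σ-mask-step A? A′? S? C? {y} {r} {k} 0≤y A⊆ C⊆S sk ¬ck 1≤yk le = begin
  Σℚ (λ i → ind (A? i))                                 ≤⟨ Σ-mono lower ⟩
  Σℚ (λ i → ind (i ≟ r) + ind (A′? i))                  ≡⟨ Σ-distrib-+ (λ i → ind (i ≟ r)) (λ i → ind (A′? i)) ⟩
  Σℚ (λ i → ind (i ≟ r)) + Σℚ (λ i → ind (A′? i))
    ≤⟨ +-mono-≤ (≤-reflexive (trans (Σ-mask-≡ r 1ℚ) (sym (Σ-mask-≡ k 1ℚ)))) le ⟩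
  Σℚ (λ i → ind (i ≟ k)) + Σℚ (λ i → mask (C? i) (y i)) ≡⟨ Σ-distrib-+ (λ i → ind (i ≟ k)) (λ i → mask (C? i) (y i)) ⟨
  Σℚ (λ i → ind (i ≟ k) + mask (C? i) (y i))            ≤⟨ Σ-mono upper ⟩
  Σℚ (λ i → mask (S? i) (y i))                          ∎
  where
  open ≤-Reasoning
  lower : ∀ i → ind (A? i) ≤ ind (i ≟ r) + ind (A′? i)
  lower i with A? i
  ... | no _ = +-mono-≤ (mask-nonNeg (i ≟ r) 0≤1) (mask-nonNeg (A′? i) 0≤1)
  ... | yes a with A⊆ a
  ...   | inj₁ e  = +-mono-≤ (≤-reflexive (sym (mask-yes (i ≟ r) 1ℚ e))) (mask-nonNeg (A′? i) 0≤1)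
  ...   | inj₂ a′ = +-mono-≤ (mask-nonNeg (i ≟ r) 0≤1) (≤-reflexive (sym (mask-yes (A′? i) 1ℚ a′)))

  upper : ∀ i → ind (i ≟ k) + mask (C? i) (y i) ≤ mask (S? i) (y i)
  upper i with i ≟ k | C? i
  ... | yes refl | yes c = ⊥-elim (¬ck c)
  ... | yes refl | no _  = ≤-trans 1≤yk (≤-reflexive (sym (mask-yes (S? i) (y i) sk)))
  ... | no _     | no _  = mask-nonNeg (S? i) (0≤y i)
  ... | no _     | yes c = ≤-reflexive (trans (+-identityˡ (y i)) (sym (mask-yes (S? i) (y i) (C⊆S c))))

module Domination {n : ℕ} (U : Tree n) (x : Fin n → Fin n → ℚ) (x-nonNeg : ∀ i j → 0ℚ ≤ x i j) where

  open Segments U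
  open STT U

  -- What a covering constraint leaves at an integer point: some X or Z term is at least 1, and
  -- `Z k i j` is bounded by both `X k i` and `X k j`.
  Joined : V → V → Set
  Joined i j = 1ℚ ≤ x i j ⊎ 1ℚ ≤ x j i ⊎ ∃[ k ] (k ∈ seg i j × 1ℚ ≤ x k i × 1ℚ ≤ x k j)

  Reach : Subset n → V → V → Set
  Reach S j z = ∃[ i ] (i ∈ₛ S × (i ≡ j ⊎ 1ℚ ≤ x i j) × z ∈ seg i j)

  reach? : ∀ S j → Decidable (Reach S j)
  reach? S j z = any? λ i → (i ∈ₛ? S) ×-dec (((i ≟ j) ⊎-dec (1ℚ ≤? x i j)) ×-dec (z ∈? seg i j))

  reach-convex : ∀ S j → Convex (Reach S j)
  reach-convex S j = starShaped⇒convex λ (i , i∈ , e , x∈) z∈ → i , i∈ , e , seg-suffix x∈ z∈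

  module _ (joined : ∀ {i j} → i ≢ j → Joined i j) where

    common-reach : ∀ S → Convex (_∈ₛ S) → ∃ (_∈ₛ S) → ∃[ r ] (r ∈ₛ S × (∀ {j} → j ∈ₛ S → Reach S j r))
    common-reach S cS ne =
      -- Starting the accumulator at S places the common vertex in S.
      let r , r∈ , all = helly (reach? S) (reach-convex S) meet (_∈ₛ? S) cS ne (λ j∈ → _ , j∈ , self j∈)
                               (AllP.all-filter (_∈ₛ? S) (allFin n))
      in r , r∈ , λ j∈ → All.lookup all (∈-filter⁺ (_∈ₛ? S) (∈-allFin _) j∈)
      where
      self : ∀ {j} → j ∈ₛ S → Reach S j j
      self j∈ = _ , j∈ , inj₁ refl , source∈seg _ _

      meet : ∀ {i j} → i ∈ₛ S → j ∈ₛ S → ∃[ z ] (Reach S i z × Reach S j z)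
      meet {i} {j} i∈ j∈ with i ≟ j
      ... | yes refl = i , self i∈ , self i∈
      ... | no i≢j with joined i≢j
      ...   | inj₁ e        = i , self i∈ , (i , i∈ , inj₂ e , source∈seg i j)
      ...   | inj₂ (inj₁ e) = j , (j , j∈ , inj₂ e , source∈seg j i) , self j∈
      ...   | inj₂ (inj₂ (k , k∈ , e , e′)) =
              k , (k , cS i∈ j∈ k∈ , inj₂ e , source∈seg k i) , (k , cS i∈ j∈ k∈ , inj₂ e′ , source∈seg k j)

    -- The depth bound counts only mass coming from within S. What comes from outside a component
    -- stays available to pay for the ancestors above it.
    record Dominating (S : V → Set) (S? : Decidable S) (T : RT n) : Set₁ where
      field
        stt   : IsSTT U S T
        ∈T⇒S  : ∀ {z} → z ∈T T → S z
        depth : ∀ {j} → S j → Σℚ (λ i → ind (anc? T i j)) ≤ Σℚ (λ i → mask (S? i) (x i j))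

    module Step (S : Subset n) (cS : Convex (_∈ₛ S))
      (rec : ∀ S′ → S′ ⊂ S → Convex (_∈ₛ S′) → ∃ (_∈ₛ S′) → Σ (RT n) (Dominating (_∈ₛ S′) (_∈ₛ? S′)))
      (r : V) (r∈ : r ∈ₛ S) (reach : ∀ {j} → j ∈ₛ S → Reach S j r) where

      S∖r : V → Set
      S∖r z = z ∈ₛ S × z ≢ r

      C : V → V → Set
      C c = Linked S∖r c

      C? : ∀ c → Decidable (C c)
      C? c = linked? (λ z → (z ∈ₛ? S) ×-dec ¬? (z ≟ r)) c

      Cₛ : V → Subset n
      Cₛ c = comprehension (C? c)

      to : ∀ {c z} → C c z → z ∈ₛ Cₛ c
      to = ∈-comprehension⁺ (C? _)

      from : ∀ {c z} → z ∈ₛ Cₛ c → C c z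
      from = ∈-comprehension⁻ (C? _)

      -- The neighbours of r in S represent the components left after removing r, each exactly once.
      Q : V → Set
      Q c = c ∈ₛ S × Adj U r c

      Q? : Decidable Q
      Q? c = (c ∈ₛ? S) ×-dec adj? r c

      adj⇒≢ : ∀ {c} → Adj U r c → c ≢ r
      adj⇒≢ a refl = Adj-irr U a

      convexC : ∀ c → Convex (_∈ₛ Cₛ c)
      convexC c x∈ y∈ z∈ =
        to (linked-trans (from x∈)
          (linked⇒seg (linked-within (linked-trans (linked-sym (from x∈)) (from y∈))) z∈))

      child : ∀ c → Q c → Σ (RT n) (Dominating (_∈ₛ Cₛ c) (_∈ₛ? Cₛ c))
      child c (c∈ , a) = rec (Cₛ c)
        ((λ z∈ → proj₁ (linked-target (from z∈))) , r , r∈ , λ r∈C → proj₂ (linked-target (from r∈C)) refl)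
        (convexC c) (c , to (linked-refl (c∈ , adj⇒≢ a)))

      chosen : Σ (V → RT n) λ f → ∀ c → Q c → Dominating (_∈ₛ Cₛ c) (_∈ₛ? Cₛ c) (f c)
      chosen = choose (node r []) Q? child

      f : V → RT n
      f = proj₁ chosen

      module F {c} (q : Q c) = Dominating (proj₂ chosen c q)

      f⇒C : ∀ {c z} → Q c → z ∈T f c → C c z
      f⇒C q z∈ = from (F.∈T⇒S q z∈)

      C⇒f : ∀ {c z} → Q c → C c z → z ∈T f c
      C⇒f q l = stt-nodes (F.stt q) _ (to l)

      cs : List V
      cs = filter Q? (allFin n)

      Qcs : All Q cs
      Qcs = AllP.all-filter Q? (allFin n)

      ts : List (RT n)
      ts = map f cs

      sub : ∀ {c} → Q c → SubSTT (_∈ₛ S) r (f c)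
      sub q = ((λ z z∈ → linked-target (f⇒C q z∈))
              , (λ y z y∈ z∈ → linked-trans (linked-sym (f⇒C q y∈)) (f⇒C q z∈))
              , (λ y z y∈ sz a → C⇒f q (linked-trans (f⇒C q y∈)
                  (linked-step (linked-target (f⇒C q y∈)) a (linked-refl sz)))))
            , stt-resp (λ z∈ → C⇒f q (from z∈)) (F.∈T⇒S q) (F.stt q)

      -- The path from c to c′ consists of the two edges through r, whereas a common node z would
      -- link c to c′ by a walk avoiding r.
      apart : ∀ {c c′} → Q c → Q c′ → c ≢ c′ → DisjointT (f c) (f c′)
      apart {c} {c′} q@(_ , a) q′@(_ , a′) c≢c′ z z∈ z∈′ =
        proj₂ (linked⇒seg (linked-trans (f⇒C q z∈) (linked-sym (f⇒C q′ z∈′))) r∈cc′) refl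
        where
        r∈cc′ : r ∈ seg c c′
        r∈cc′ = subst (r ∈_)
          (seg-unique (step (Adj-sym U a) (step a′ stop)
                      , (adj⇒≢ a ∷ c≢c′ ∷ []) ∷ ((adj⇒≢ a′ ∘ sym) ∷ []) ∷ [] ∷ []))
          (there (here refl))

      disjoint : AllPairs DisjointT ts
      disjoint = AllPairsP.map⁺ (allPairs-strengthen apart Qcs (UniqueP.filter⁺ Q? (UniqueP.allFin⁺ n)))

      -- The second vertex of the path from r to z represents the component of z, since a path does
      -- not return to r.
      first-step : ∀ {z p} → IsPath (Adj U) r z p → (∀ {y} → y ∈ p → y ∈ₛ S) → z ≢ r → ∃[ c ] (Q c × C c z)
      first-step (stop , _) _ z≢r = ⊥-elim (z≢r refl)
      first-step (step a w , r∉ ∷ _) p⊆S _ =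
        _ , (p⊆S (there (source∈ w)) , a) , _ , w ,
        All.tabulate λ y∈ → p⊆S (there y∈) , λ { refl → All.lookup r∉ y∈ refl }

      cover : ∀ z → z ∈ₛ S → z ≢ r → Any (z ∈T_) ts
      cover z z∈ z≢r =
        let c , q , l = first-step (seg-path r z) (cS r∈ z∈) z≢r
        in AnyP.map⁺ (lose (∈-filter⁺ Q? (∈-allFin c) q) (C⇒f q l))

      stt′ : IsSTT U (_∈ₛ S) (node r ts)
      stt′ = mk r∈ (AllP.map⁺ (All.map sub Qcs)) cover disjoint

      subtree : ∀ {t} → t ∈ ts → ∃[ c ] (Q c × t ≡ f c)
      subtree t∈ = let c , c∈ , e = ∈-map⁻ f t∈ in c , All.lookup Qcs c∈ , e

      child⇒S∖r : ∀ {t z} → t ∈ ts → z ∈T t → S∖r z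
      child⇒S∖r t∈ z∈ with subtree t∈
      ... | c , q , refl = linked-target (f⇒C q z∈)

      ∈T⇒S′ : ∀ {z} → z ∈T node r ts → z ∈ₛ S
      ∈T⇒S′ here = r∈
      ∈T⇒S′ (there a) = let _ , t∈ , z∈ = find a in proj₁ (child⇒S∖r t∈ z∈)

      open Children {r = r} {ts} (λ t∈ r∈t → proj₂ (child⇒S∖r t∈ r∈t) refl) disjoint

      -- `Reach` puts r on the path from i to j, so i is outside the component of j. The alternative
      -- i = j would force j = r.
      far : ∀ {c j} → C c j → ∃[ i ] (i ∈ₛ S × ¬ C c i × 1ℚ ≤ x i j)
      far l with linked-target l
      ... | j∈ , j≢r with reach j∈
      ...   | i , i∈ , inj₁ refl , r∈seg = ⊥-elim (j≢r (sym (seg-refl r∈seg)))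
      ...   | i , i∈ , inj₂ e , r∈seg =
              i , i∈ , (λ l′ → proj₂ (linked⇒seg (linked-trans (linked-sym l′) l) r∈seg) refl) , e

      depth-child : ∀ {c j} → Q c → f c ∈ ts → j ∈T f c →
                    Σℚ (λ i → ind (anc? (node r ts) i j)) ≤ Σℚ (λ i → mask (i ∈ₛ? S) (x i j))
      depth-child {c} {j} q t∈ j∈ =
        let l = f⇒C q j∈
            k , k∈ , k∉C , 1≤xkj = far l
        in Σ-mask-step (λ i → anc? (node r ts) i j) (λ i → anc? (f c) i j) (_∈ₛ? S) (_∈ₛ? Cₛ c)
             (λ i → x-nonNeg i j) (descend-target t∈ j∈) (proj₁ ∘ linked-target ∘ from)
             k∈ (k∉C ∘ from) 1≤xkj (F.depth q (to l))

      depth-root : Σℚ (λ i → ind (anc? (node r ts) i r)) ≤ Σℚ (λ i → mask (i ∈ₛ? S) (x i r))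
      depth-root = ≤-trans
        (≤-reflexive (Σ-zero λ i → mask-no (anc? (node r ts) i r) 1ℚ no-anc-of-root))
        (Σ-nonNeg λ i → mask-nonNeg (i ∈ₛ? S) (x-nonNeg i r))

      in-child : ∀ {j} → j ∈ₛ S → j ≢ r → ∃[ c ] (Q c × f c ∈ ts × j ∈T f c)
      in-child j∈ j≢r with find (cover _ j∈ j≢r)
      ... | t , t∈ , j∈t with subtree t∈
      ...   | c , q , refl = c , q , t∈ , j∈t

      depth′ : ∀ {j} → j ∈ₛ S →
               Σℚ (λ i → ind (anc? (node r ts) i j)) ≤ Σℚ (λ i → mask (i ∈ₛ? S) (x i j))
      depth′ {j} j∈ = case j ≟ r of λ
        { (yes refl) → depth-root
        ; (no j≢r)   → let _ , q , t∈ , j∈t = in-child j∈ j≢r in depth-child q t∈ j∈t }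

      tree : Σ (RT n) (Dominating (_∈ₛ S) (_∈ₛ? S))
      tree = node r ts , record { stt = stt′ ; ∈T⇒S = ∈T⇒S′ ; depth = depth′ }

    dominating : ∀ S → Acc _⊂_ S → Convex (_∈ₛ S) → ∃ (_∈ₛ S) → Σ (RT n) (Dominating (_∈ₛ S) (_∈ₛ? S))
    dominating S (acc rec) cS ne =
      let r , r∈ , reach = common-reach S cS ne
      in Step.tree S cS (λ S′ S′⊂S → dominating S′ (rec S′⊂S)) r r∈ reach

    -- The vertex v makes the initial node set nonempty, as any tree has a root.
    dominating-stt : V → ∃[ T ] Σ (IsSTTOver U T) λ _ → ∀ j → Σℚ (λ i → ind (anc? T i j)) ≤ Σℚ (λ i → x i j)
    dominating-stt v = relax (dominating ⊤ₛ (⊂-wellFounded ⊤ₛ) (λ _ _ _ → ∈⊤ₛ) (v , ∈⊤ₛ))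
      where
      relax : Σ (RT n) (Dominating (_∈ₛ ⊤ₛ) (_∈ₛ? ⊤ₛ)) →
              ∃[ T ] Σ (IsSTTOver U T) λ _ → ∀ j → Σℚ (λ i → ind (anc? T i j)) ≤ Σℚ (λ i → x i j)
      relax (T , d) = T , stt-resp (λ _ → tt) (λ _ → ∈⊤ₛ) (Dominating.stt d) ,
        λ j → ≤-trans (Dominating.depth d ∈⊤ₛ) (Σ-mono λ i → mask-≤ (i ∈ₛ? ⊤ₛ) (x-nonNeg i j))

-- The point induced by an STT

-- Recursion runs from descendants to ancestors, hence the `flip`. It offers the weight of j only
-- along a proof of `i ≺ j`, so `extend` is a `mask` whose value may depend on that proof.
descendant-weights : ∀ {n} {_≺_ : Fin n → Fin n → Set} (≺? : ∀ i j → Dec (i ≺ j)) → WF.WellFounded (flip _≺_) →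
  ∃[ w ] (∀ i → 0ℚ ≤ w i) × (∀ i → w i ≡ 1ℚ + Σℚ (λ j → mask (≺? i j) (w j)))
descendant-weights {n} {_≺_} ≺? wf = w , w-nonNeg , w-unfold
  where
  extend : ∀ {i j} → Dec (i ≺ j) → (i ≺ j → ℚ) → ℚ
  extend (yes p) h = h p
  extend (no _)  h = 0ℚ

  extend-cong : ∀ {i j} (d : Dec (i ≺ j)) {h h′} → (∀ p → h p ≡ h′ p) → extend d h ≡ extend d h′
  extend-cong (yes p) e = e p
  extend-cong (no _)  e = refl

  extend-const : ∀ {i j} (d : Dec (i ≺ j)) q → extend d (λ _ → q) ≡ mask d q
  extend-const (yes _) q = refl
  extend-const (no _)  q = refl

  f : ∀ i → (∀ {j} → i ≺ j → ℚ) → ℚ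
  f i rec = 1ℚ + Σℚ (λ j → extend (≺? i j) rec)

  f-ext : ∀ i {r r′ : ∀ {j} → i ≺ j → ℚ} → (∀ {j} (p : i ≺ j) → r p ≡ r′ p) → f i r ≡ f i r′
  f-ext i e = cong (1ℚ +_) (Σ-cong λ j → extend-cong (≺? i j) e)

  w : Fin n → ℚ
  w = WF.All.wfRec wf 0ℓ (λ _ → ℚ) f

  w-unfold : ∀ i → w i ≡ 1ℚ + Σℚ (λ j → mask (≺? i j) (w j))
  w-unfold i = trans (WF.FixPoint.unfold-wfRec wf (λ _ → ℚ) f f-ext)
                     (cong (1ℚ +_) (Σ-cong λ j → extend-const (≺? i j) (w j)))

  w-nonNeg : ∀ i → 0ℚ ≤ w i
  w-nonNeg = WF.All.wfRec wf 0ℓ (λ i → 0ℚ ≤ w i) λ i rec →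
    ≤-trans (+-mono-≤ 0≤1 (Σ-nonNeg λ j → summand i j rec)) (≤-reflexive (sym (w-unfold i)))
    where
    summand : ∀ i j → (∀ {j} → i ≺ j → 0ℚ ≤ w j) → 0ℚ ≤ mask (≺? i j) (w j)
    summand i j rec with ≺? i j
    ... | yes p = rec p
    ... | no _  = ≤-refl

isInt-nonNeg : ∀ {q} → IsInt q → 0ℚ ≤ q → q ≡ 0ℚ ⊎ 1ℚ ≤ q
isInt-nonNeg {q} (z , refl) 0≤q = cases z (ℚP.↥p/↧p≡p (whole z)) 0≤q
  where
  -- `z / 1` normalises through a gcd; `whole z` is its reduced form, on which comparisons compute.
  whole : ℤ → ℚ
  whole z = mkℚ z 0 (Coprimality.sym (Coprimality.1-coprimeTo ∣ z ∣))
  cases : ∀ z → z / 1 ≡ whole z → 0ℚ ≤ z / 1 → z / 1 ≡ 0ℚ ⊎ 1ℚ ≤ z / 1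
  cases (pos zero)    e h = inj₁ refl
  cases (pos (suc m)) e h = inj₂ (≤-trans (*≤* (+≤+ (s≤s z≤n))) (≤-reflexive (sym e)))
  cases -[1+ m ]      e h with ≤-trans h (≤-reflexive e)
  ... | *≤* ()

obj-cong : ∀ {n} (w : Fin n → ℚ) {d e : Fin n → ℚ} → (∀ i → d i ≡ e i) → obj w d ≡ obj w e
obj-cong w h = Σ-cong λ i → cong (w i *_) (h i)

obj-mono : ∀ {n} {w d e : Fin n → ℚ} → (∀ i → 0ℚ ≤ w i) → (∀ i → d i ≤ e i) → obj w d ≤ obj w e
obj-mono 0≤w h = Σ-mono λ i → *-monoˡ-≤ (0≤w i) (h i)

module InducedPoint {n : ℕ} (U : Tree n) (T : RT n) (stt : IsSTTOver U T) where

  open Segments U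
  open STT U
  open AncestorLaws (stt-laws stt (λ _ _ → seg⇒linked λ _ → tt))

  ∈T : ∀ i → i ∈T T
  ∈T i = stt-nodes stt i tt

  ancEq? : ∀ i j → Dec (AncEq T i j)
  ancEq? i j = ((i ≟ j) ×-dec (j ∈T? T)) ⊎-dec anc? T i j

  lca? : ∀ k i j → Dec (IsLCA T k i j)
  lca? k i j = ancEq? k i ×-dec (ancEq? k j ×-dec
    all? λ m → anc? T k m →-dec ¬? (ancEq? m i ×-dec ancEq? m j))

  betweenLCA? : ∀ k i j → Dec (Between U k i j × IsLCA T k i j)
  betweenLCA? k i j = between? k i j ×-dec lca? k i j

  point : Point n
  point = pt (λ j → Σℚ (λ i → ind (anc? T i j))) (λ i j → ind (anc? T i j)) (λ k i j → ind (betweenLCA? k i j))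

  induced⇒≐ : ∀ {P} → InducedBy U T P → P ≐ point
  induced⇒≐ {P} (hX , hZ , hD) = (λ i → trans (hD i) (Σ-cong λ j → X≡ j i)) , X≡ , Z≡
    where
    X≡ : ∀ i j → X P i j ≡ ind (anc? T i j)
    X≡ i j with anc? T i j
    ... | yes a = proj₁ (hX i j) a
    ... | no ¬a = proj₂ (hX i j) ¬a
    Z≡ : ∀ k i j → Z P k i j ≡ ind (betweenLCA? k i j)
    Z≡ k i j with betweenLCA? k i j
    ... | yes b = proj₁ (hZ k i j) b
    ... | no ¬b = proj₂ (hZ k i j) ¬b

  ≐⇒induced : ∀ {P} → P ≐ point → InducedBy U T P
  ≐⇒induced (D≡ , X≡ , Z≡) =
      (λ i j → (λ a → trans (X≡ i j) (mask-yes (anc? T i j) 1ℚ a)) , (λ ¬a → trans (X≡ i j) (mask-no (anc? T i j) 1ℚ ¬a)))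
    , (λ k i j → (λ b → trans (Z≡ k i j) (mask-yes (betweenLCA? k i j) 1ℚ b))
               , (λ ¬b → trans (Z≡ k i j) (mask-no (betweenLCA? k i j) 1ℚ ¬b)))
    , (λ i → trans (D≡ i) (Σ-cong λ j → sym (X≡ j i)))

  -- By `separates`, no common ancestor of i and j lies strictly below a vertex of their path.
  anc⇒lca : ∀ {k i j} → Between U k i j → Anc T k i → Anc T k j → IsLCA T k i j
  anc⇒lca b ki kj = inj₂ ki , inj₂ kj , λ m km (mi , mj) → separates (proj₁ (between⇒inner b)) km mi mj

  lca⇒anc : ∀ {k i j} → Between U k i j → IsLCA T k i j → Anc T k i × Anc T k j
  lca⇒anc (_ , _ , _ , k≢i , k≢j) (ki , kj , _) = strict k≢i ki , strict k≢j kj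
    where
    strict : ∀ {k i} → k ≢ i → AncEq T k i → Anc T k i
    strict k≢i (inj₁ (e , _)) = ⊥-elim (k≢i e)
    strict k≢i (inj₂ a)       = a

  lca-sym : ∀ {k i j} → IsLCA T k i j → IsLCA T k j i
  lca-sym (ki , kj , low) = kj , ki , λ m km → low m km ∘ swap

  lca-unique : ∀ {k k′ i j} → Between U k i j → IsLCA T k i j → Between U k′ i j → IsLCA T k′ i j → k ≡ k′
  lca-unique b l@(_ , _ , low) b′ l′@(_ , _ , low′) with lca⇒anc b l | lca⇒anc b′ l′
  ... | ki , kj | k′i , k′j with chain ki k′i
  ...   | inj₁ e         = e
  ...   | inj₂ (inj₁ a)  = ⊥-elim (low _ a (inj₂ k′i , inj₂ k′j))
  ...   | inj₂ (inj₂ a)  = ⊥-elim (low′ _ a (inj₂ ki , inj₂ kj))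

  point-feasible : Feasible U point
  point-feasible =
      (λ i j → X≥0 i j)
    , (λ k i j → Z≥0 k i j)
    , (λ i → mask-no (anc? T i i) 1ℚ irrefl)
    , (λ k i j ¬b → mask-no (betweenLCA? k i j) 1ℚ (¬b ∘ proj₁))
    , Z-sym
    , pair
    , (λ k i j b → Z≤X k i j (λ l → proj₁ (lca⇒anc b l)) , Z≤X k i j (λ l → proj₂ (lca⇒anc b l)))
    , (λ i → ≤-refl)
    where
    X≥0 : ∀ i j → 0ℚ ≤ X point i j
    X≥0 i j = mask-nonNeg (anc? T i j) 0≤1
    Z≥0 : ∀ k i j → 0ℚ ≤ Z point k i j
    Z≥0 k i j = mask-nonNeg (betweenLCA? k i j) 0≤1
    ΣZ≥0 : ∀ i j → 0ℚ ≤ Σℚ (λ k → Z point k i j)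
    ΣZ≥0 i j = Σ-nonNeg λ k → Z≥0 k i j

    Z-sym : ∀ k i j → Z point k i j ≡ Z point k j i
    Z-sym k i j with betweenLCA? k i j
    ... | yes (b , l) = sym (mask-yes (betweenLCA? k j i) 1ℚ (between-sym b , lca-sym l))
    ... | no ¬bl      = sym (mask-no (betweenLCA? k j i) 1ℚ λ (b , l) → ¬bl (between-sym b , lca-sym l))

    Z≤X : ∀ k i j {m} → (IsLCA T k i j → Anc T k m) → Z point k i j ≤ X point k m
    Z≤X k i j {m} h with betweenLCA? k i j
    ... | yes (_ , l) = ≤-reflexive (sym (mask-yes (anc? T k m) 1ℚ (h l)))
    ... | no _        = X≥0 k m

    pair : ∀ i j → i ≢ j → 1ℚ ≤ (X point i j + X point j i) + Σℚ (λ k → Z point k i j)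
    -- The three cases of `split` match the three terms of the covering constraint.
    pair i j i≢j with split (∈T i) (∈T j) i≢j
    ... | inj₁ a = +-mono-≤ (+-mono-≤ (≤-reflexive (sym (mask-yes (anc? T i j) 1ℚ a))) (X≥0 j i)) (ΣZ≥0 i j)
    ... | inj₂ (inj₁ a) = +-mono-≤ (+-mono-≤ (X≥0 i j) (≤-reflexive (sym (mask-yes (anc? T j i) 1ℚ a)))) (ΣZ≥0 i j)
    ... | inj₂ (inj₂ (k , k∈ , ki , kj)) =
      +-mono-≤ (+-mono-≤ (X≥0 i j) (X≥0 j i))
        (≤-trans (≤-reflexive (sym (mask-yes (betweenLCA? k i j) 1ℚ (b , anc⇒lca b ki kj))))
                 (term≤Σ (λ k → Z≥0 k i j) k))
      where
      b : Between U k i j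
      b = inner⇒between (k∈ , (λ { refl → irrefl ki }) , (λ { refl → irrefl kj }))

  weights : ∃[ w ] (∀ i → 0ℚ ≤ w i) × (∀ i → w i ≡ 1ℚ + Σℚ (λ j → mask (anc? T i j) (w j)))
  weights = descendant-weights (anc? T) (spo-noetherian (record
    { isEquivalence = isEquivalence ; irrefl = λ { refl → irrefl } ; trans = transitive ; <-resp-≈ = resp₂ (Anc T) }))

  w : Fin n → ℚ
  w = proj₁ weights

  w-nonNeg : ∀ i → 0ℚ ≤ w i
  w-nonNeg = proj₁ (proj₂ weights)

  w-unfold : ∀ i → w i ≡ 1ℚ + Σℚ (λ j → mask (anc? T i j) (w j))
  w-unfold = proj₂ (proj₂ weights)

  module Optimality (Q : Point n) (feasible : Feasible U Q) where

    X-nonNeg : ∀ i j → 0ℚ ≤ X Q i j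
    X-nonNeg = proj₁ feasible
    Z-nonNeg : ∀ k i j → 0ℚ ≤ Z Q k i j
    Z-nonNeg = proj₁ (proj₂ feasible)
    Z-zero : ∀ k i j → ¬ Between U k i j → Z Q k i j ≡ 0ℚ
    Z-zero = proj₁ (proj₂ (proj₂ (proj₂ feasible)))
    cover : ∀ i j → i ≢ j → 1ℚ ≤ (X Q i j + X Q j i) + Σℚ (λ k → Z Q k i j)
    cover = proj₁ (proj₂ (proj₂ (proj₂ (proj₂ (proj₂ feasible)))))
    Z≤X : ∀ k i j → Between U k i j → (Z Q k i j ≤ X Q k i) × (Z Q k i j ≤ X Q k j)
    Z≤X = proj₁ (proj₂ (proj₂ (proj₂ (proj₂ (proj₂ (proj₂ feasible))))))
    ΣX≤D : ∀ i → Σℚ (λ j → X Q j i) ≤ D Q i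
    ΣX≤D = proj₂ (proj₂ (proj₂ (proj₂ (proj₂ (proj₂ (proj₂ feasible))))))

    badX : Fin n → Fin n → ℚ
    badX k i = mask (¬? (anc? T k i)) (X Q k i)

    badX-nonNeg : ∀ k i → 0ℚ ≤ badX k i
    badX-nonNeg k i = mask-nonNeg (¬? (anc? T k i)) (X-nonNeg k i)

    bad : Fin n → ℚ
    bad i = Σℚ (λ k → badX k i)

    bad-nonNeg : ∀ i → 0ℚ ≤ bad i
    bad-nonNeg i = Σ-nonNeg λ k → badX-nonNeg k i

    -- No vertex k strictly between i and a descendant j of i is an ancestor of i, so Z k i j ≤ X k i is charged to bad i.
    anc⇒cover : ∀ {i j} → Anc T i j → 1ℚ ≤ X Q i j + bad i
    anc⇒cover {i} {j} a = begin
      1ℚ                                                       ≤⟨ cover i j (λ { refl → irrefl a }) ⟩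
      (X Q i j + X Q j i) + Σℚ (λ k → Z Q k i j)               ≡⟨ ℚP.+-assoc (X Q i j) (X Q j i) _ ⟩
      X Q i j + (X Q j i + Σℚ (λ k → Z Q k i j))
        -- The term `X Q j i` is entered at k = j, where Z vanishes, so that one sum over k can be
        -- charged to `bad i`.
        ≡⟨ cong (λ s → X Q i j + (s + Σℚ (λ k → Z Q k i j))) (Σ-mask-≡ j (X Q j i)) ⟨
      X Q i j + (Σℚ (λ k → mask (k ≟ j) (X Q j i)) + Σℚ (λ k → Z Q k i j))
        ≡⟨ cong (X Q i j +_) (Σ-distrib-+ (λ k → mask (k ≟ j) (X Q j i)) (λ k → Z Q k i j)) ⟨
      X Q i j + Σℚ (λ k → mask (k ≟ j) (X Q j i) + Z Q k i j)  ≤⟨ +-monoʳ-≤ (X Q i j) (Σ-mono charge) ⟩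
      X Q i j + bad i                                          ∎
      where
      open ≤-Reasoning
      charge : ∀ k → mask (k ≟ j) (X Q j i) + Z Q k i j ≤ badX k i
      charge k with k ≟ j
      ... | yes refl rewrite Z-zero k i k (λ b → proj₂ (proj₂ (between⇒inner b)) refl)
                           | mask-yes (¬? (anc? T k i)) (X Q k i) (λ a′ → irrefl (transitive a a′)) =
            ≤-reflexive (+-identityʳ (X Q k i))
      ... | no _ with between? k i j
      ...   | no ¬b rewrite Z-zero k i j ¬b = badX-nonNeg k i
      ...   | yes b rewrite mask-yes (¬? (anc? T k i)) (X Q k i)
                              (λ ki → separates (proj₁ (between⇒inner b)) ki (inj₁ (refl , ∈T i)) (inj₂ a)) =
              ≤-trans (≤-reflexive (+-identityˡ _)) (proj₁ (Z≤X k i j b))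

    -- Bounds the total by which the entries `X Q i j` over the ancestors i of j can fall short of
    -- 1.
    debt : Fin n → ℚ
    debt j = Σℚ (λ i → mask (anc? T i j) (bad i))

    -- An ancestor i of j contributes at least 1 minus `bad i`; the entries of the other i add up to
    -- `bad j`.
    D-lower : ∀ j → D point j + bad j ≤ D Q j + debt j
    D-lower j = begin
      D point j + bad j                                      ≡⟨ Σ-distrib-+ (λ i → ind (anc? T i j)) (λ i → badX i j) ⟨
      Σℚ (λ i → ind (anc? T i j) + badX i j)                 ≤⟨ Σ-mono entry ⟩
      Σℚ (λ i → X Q i j + mask (anc? T i j) (bad i))         ≡⟨ Σ-distrib-+ (λ i → X Q i j) (λ i → mask (anc? T i j) (bad i)) ⟩
      Σℚ (λ i → X Q i j) + debt j                            ≤⟨ ℚP.+-monoˡ-≤ (debt j) (ΣX≤D j) ⟩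
      D Q j + debt j                                         ∎
      where
      open ≤-Reasoning
      entry : ∀ i → ind (anc? T i j) + badX i j ≤ X Q i j + mask (anc? T i j) (bad i)
      entry i with anc? T i j
      ... | yes a = anc⇒cover a
      ... | no _  = ≤-reflexive (ℚP.+-comm 0ℚ (X Q i j))

    -- After the sums are exchanged, the coefficient of `bad i` in the weighted debt is the total
    -- weight of the descendants of i, which is `w i` minus 1 by the recursion for w. One unit of
    -- `bad i` is left over.
    total-debt : Σℚ (λ j → w j * bad j) ≡ Σℚ bad + Σℚ (λ j → w j * debt j)
    total-debt = begin
      Σℚ (λ i → w i * bad i)
        ≡⟨ Σ-cong (λ i → trans (cong (_* bad i) (w-unfold i)) (expand (Σℚ (λ j → mask (anc? T i j) (w j))) (bad i))) ⟩
      Σℚ (λ i → bad i + bad i * Σℚ (λ j → mask (anc? T i j) (w j)))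
        ≡⟨ Σ-distrib-+ bad (λ i → bad i * Σℚ (λ j → mask (anc? T i j) (w j))) ⟩
      Σℚ bad + Σℚ (λ i → bad i * Σℚ (λ j → mask (anc? T i j) (w j)))
        ≡⟨ cong (Σℚ bad +_) (Σ-cong λ i → Σ-distrib-* (bad i) (λ j → mask (anc? T i j) (w j))) ⟩
      Σℚ bad + Σℚ (λ i → Σℚ (λ j → bad i * mask (anc? T i j) (w j)))
        ≡⟨ cong (Σℚ bad +_) (Σ-swap (λ i j → bad i * mask (anc? T i j) (w j))) ⟩
      Σℚ bad + Σℚ (λ j → Σℚ (λ i → bad i * mask (anc? T i j) (w j)))
        ≡⟨ cong (Σℚ bad +_) (Σ-cong λ j → Σ-cong λ i → commute i j) ⟩
      Σℚ bad + Σℚ (λ j → Σℚ (λ i → w j * mask (anc? T i j) (bad i)))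
        ≡⟨ cong (Σℚ bad +_) (Σ-cong λ j → Σ-distrib-* (w j) (λ i → mask (anc? T i j) (bad i))) ⟨
      Σℚ bad + Σℚ (λ j → w j * debt j) ∎
      where
      open ≡-Reasoning
      expand : ∀ s b → (1ℚ + s) * b ≡ b + b * s
      expand s b = trans (ℚP.*-distribʳ-+ b 1ℚ s) (cong₂ _+_ (ℚP.*-identityˡ b) (ℚP.*-comm s b))
      commute : ∀ i j → bad i * mask (anc? T i j) (w j) ≡ w j * mask (anc? T i j) (bad i)
      commute i j with anc? T i j
      ... | yes _ = ℚP.*-comm (bad i) (w j)
      ... | no _  = trans (ℚP.*-zeroʳ (bad i)) (sym (ℚP.*-zeroʳ (w j)))

    obj-lower : obj w (D point) + Σℚ bad ≤ obj w (D Q)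
    -- Adding the weighted debt K to both sides avoids subtraction.
    obj-lower = +-cancelˡ-≤ K (begin
      K + (obj w (D point) + Σℚ bad)                 ≡⟨ rotate K (obj w (D point)) (Σℚ bad) ⟩
      obj w (D point) + (Σℚ bad + K)                 ≡⟨ cong (obj w (D point) +_) total-debt ⟨
      obj w (D point) + obj w bad                    ≡⟨ Σ-distrib-+ (λ j → w j * D point j) (λ j → w j * bad j) ⟨
      Σℚ (λ j → w j * D point j + w j * bad j)       ≡⟨ Σ-cong (λ j → ℚP.*-distribˡ-+ (w j) (D point j) (bad j)) ⟨
      obj w (λ j → D point j + bad j)                ≤⟨ obj-mono w-nonNeg D-lower ⟩
      obj w (λ j → D Q j + debt j)                   ≡⟨ Σ-cong (λ j → ℚP.*-distribˡ-+ (w j) (D Q j) (debt j)) ⟩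
      Σℚ (λ j → w j * D Q j + w j * debt j)          ≡⟨ Σ-distrib-+ (λ j → w j * D Q j) (λ j → w j * debt j) ⟩
      obj w (D Q) + K                                ≡⟨ ℚP.+-comm (obj w (D Q)) K ⟩
      K + obj w (D Q)                                ∎)
      where
      open ≤-Reasoning
      K : ℚ
      K = obj w debt
      rotate : ∀ k p b → k + (p + b) ≡ p + (b + k)
      rotate k p b = trans (ℚP.+-comm k (p + b)) (ℚP.+-assoc p b k)

    point-minimal : obj w (D point) ≤ obj w (D Q)
    point-minimal = ≤-trans (≤-reflexive (sym (+-identityʳ _)))
      (≤-trans (+-monoʳ-≤ (obj w (D point)) (Σ-nonNeg bad-nonNeg)) obj-lower)

    module _ (tight : obj w (D Q) ≡ obj w (D point)) where

      bad≡0 : ∀ i → bad i ≡ 0ℚ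
      bad≡0 = Σ-mono-tight bad-nonNeg (≤-trans
        (+-cancelˡ-≤ (obj w (D point)) (≤-trans obj-lower
          (≤-reflexive (trans tight (sym (+-identityʳ _))))))
        (≤-reflexive (sym (Σ-zero {n} λ _ → refl))))

      anc≤X : ∀ i j → ind (anc? T i j) ≤ X Q i j
      anc≤X i j with anc? T i j
      ... | no _  = X-nonNeg i j
      ... | yes a = ≤-trans (anc⇒cover a) (≤-reflexive (trans (cong (X Q i j +_) (bad≡0 i)) (+-identityʳ _)))

      point≤D : ∀ j → D point j ≤ D Q j
      point≤D j = ≤-trans (Σ-mono λ i → anc≤X i j) (ΣX≤D j)

      w-positive : ∀ j → 1ℚ ≤ w j
      w-positive j = ≤-trans (+-monoʳ-≤ 1ℚ (Σ-nonNeg λ i → mask-nonNeg (anc? T j i) (w-nonNeg i)))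
        (≤-reflexive (sym (w-unfold j)))

      -- Each D-coordinate of Q is at least that of `point`, so equal objectives force equal
      -- weighted coordinates, and the positive weights cancel.
      D≡ : ∀ j → D Q j ≡ D point j
      D≡ j = ≤-antisym
        (ℚP.*-cancelˡ-≤-pos (w j) {{positive (ℚP.<-≤-trans (ℚP.positive⁻¹ 1ℚ) (w-positive j))}}
          (≤-reflexive (Σ-mono-tight (λ j → *-monoˡ-≤ (w-nonNeg j) (point≤D j)) (≤-reflexive tight) j)))
        (point≤D j)

      -- Column j of X is squeezed: it dominates the ancestor indicators termwise, but its sum is at
      -- most `D Q j`, their number.
      X≡ : ∀ i j → X Q i j ≡ X point i j
      X≡ i j = Σ-mono-tight (λ i → anc≤X i j) (≤-trans (ΣX≤D j) (≤-reflexive (D≡ j))) i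

      X≡1 : ∀ {i j} → Anc T i j → X Q i j ≡ 1ℚ
      X≡1 {i} {j} a = trans (X≡ i j) (mask-yes (anc? T i j) 1ℚ a)

      X≡0 : ∀ {i j} → ¬ Anc T i j → X Q i j ≡ 0ℚ
      X≡0 {i} {j} ¬a = trans (X≡ i j) (mask-no (anc? T i j) 1ℚ ¬a)

      Z≡0 : ∀ {k i j} → ¬ (Between U k i j × IsLCA T k i j) → Z Q k i j ≡ 0ℚ
      Z≡0 {k} {i} {j} ¬bl with between? k i j
      ... | no ¬b = Z-zero k i j ¬b
      ... | yes b with anc? T k i | anc? T k j
      ...   | yes ki | yes kj = ⊥-elim (¬bl (b , anc⇒lca b ki kj))
      ...   | no ¬ki | _      = ≤-antisym (≤-trans (proj₁ (Z≤X k i j b)) (≤-reflexive (X≡0 ¬ki))) (Z-nonNeg k i j)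
      ...   | _      | no ¬kj = ≤-antisym (≤-trans (proj₂ (Z≤X k i j b)) (≤-reflexive (X≡0 ¬kj))) (Z-nonNeg k i j)

      -- Neither of i, j is an ancestor of the other and no other vertex is their lowest common
      -- ancestor, so the covering constraint reduces to 1 ≤ `Z Q k i j`.
      Z≡1 : ∀ {k i j} → Between U k i j → IsLCA T k i j → Z Q k i j ≡ 1ℚ
      Z≡1 {k} {i} {j} b l@(_ , _ , low) = ≤-antisym
          (≤-trans (proj₁ (Z≤X k i j b)) (≤-reflexive (X≡1 ki)))
          (≤-trans (cover i j i≢j) (≤-reflexive
            (trans (cong₂ _+_ (cong₂ _+_ (X≡0 ¬ij) (X≡0 ¬ji)) (trans (Σ-cong only) (Σ-mask-≡ k (Z Q k i j)))) (+-identityˡ _))))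
        where
        ki : Anc T k i
        ki = proj₁ (lca⇒anc b l)
        kj : Anc T k j
        kj = proj₂ (lca⇒anc b l)
        ¬ij : ¬ Anc T i j
        ¬ij a = low i ki (inj₁ (refl , ∈T i) , inj₂ a)
        ¬ji : ¬ Anc T j i
        ¬ji a = low j kj (inj₂ a , inj₁ (refl , ∈T j))
        i≢j : i ≢ j
        i≢j refl = low i ki (inj₁ (refl , ∈T i) , inj₁ (refl , ∈T i))
        only : ∀ k′ → Z Q k′ i j ≡ mask (k′ ≟ k) (Z Q k i j)
        only k′ with k′ ≟ k
        ... | yes refl = refl
        ... | no k′≢k  = Z≡0 λ (b′ , l′) → k′≢k (lca-unique b′ l′ b l)

      minimizer-unique : Q ≐ point
      minimizer-unique = D≡ , X≡ , Z≡
        where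
        Z≡ : ∀ k i j → Z Q k i j ≡ Z point k i j
        Z≡ k i j with betweenLCA? k i j
        ... | yes (b , l) = Z≡1 b l
        ... | no ¬bl      = Z≡0 ¬bl

-- The two implications

≐-euclidean : ∀ {n} {P Q R : Point n} → P ≐ R → Q ≐ R → P ≐ Q
≐-euclidean (d , x , z) (d′ , x′ , z′) =
    (λ i → trans (d i) (sym (d′ i)))
  , (λ i j → trans (x i j) (sym (x′ i j)))
  , (λ k i j → trans (z k i j) (sym (z′ k i j)))

induced⇒lowerEnvelope : ∀ {n} (U : Tree n) {P} → Feasible U P → Induced U P → LowerEnvelope U P
induced⇒lowerEnvelope U {P} feasible (T , stt , ind) = w , w-nonNeg , feasible
    , (λ Q fQ → ≤-trans (≤-reflexive objP) (Optimality.point-minimal Q fQ))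
    , (λ Q fQ e → ≐-euclidean {P = Q} {P} (Optimality.minimizer-unique Q fQ (trans e objP)) P≐)
  where
  open InducedPoint U T stt
  P≐ : P ≐ point
  P≐ = induced⇒≐ {P} ind
  objP : obj w (D P) ≡ obj w (D point)
  objP = obj-cong w (proj₁ P≐)

-- If `X P i j`, `X P j i` and all `Z P k i j` were below 1, they would vanish as nonnegative
-- integers, against the covering constraint.
integer⇒joined : ∀ {n} (U : Tree n) {P} (feasible : Feasible U P) → IntegerPoint P →
  ∀ {i j} → i ≢ j → Domination.Joined U (X P) (proj₁ feasible) i j
integer⇒joined U {P} (X≥0 , Z≥0 , _ , Z-zero , _ , cover , Z≤X , _) (_ , intX , intZ) {i} {j} i≢j
  with isInt-nonNeg (intX i j) (X≥0 i j) | isInt-nonNeg (intX j i) (X≥0 j i) | any? (λ k → 1ℚ ≤? Z P k i j)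
... | inj₂ e  | _       | _     = inj₁ e
... | inj₁ _  | inj₂ e  | _     = inj₂ (inj₁ e)
... | inj₁ e₁ | inj₁ e₂ | no ¬z = ⊥-elim (1≰0 (≤-trans (cover i j i≢j)
        (≤-reflexive (cong₂ _+_ (cong₂ _+_ e₁ e₂) (Σ-zero Z≡0)))))
  where
  Z≡0 : ∀ k → Z P k i j ≡ 0ℚ
  Z≡0 k with isInt-nonNeg (intZ k i j) (Z≥0 k i j)
  ... | inj₁ e = e
  ... | inj₂ e = ⊥-elim (¬z (k , e))
... | inj₁ _  | inj₁ _  | yes (k , e) with Segments.between? U k i j
...   | no ¬b = ⊥-elim (1≰0 (≤-trans e (≤-reflexive (Z-zero k i j ¬b))))
...   | yes b = inj₂ (inj₂ (k , proj₁ (Segments.between⇒inner U b)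
                           , ≤-trans e (proj₁ (Z≤X k i j b)) , ≤-trans e (proj₂ (Z≤X k i j b))))

-- Two weight vectors take part. For v, the D-coordinates of P are the unique optimum, which forces
-- the depths of T to agree with them. The weights w of T then turn this agreement into equality of
-- points.
lowerEnvelopeD⇒induced : ∀ {n} (U : Tree (suc n)) {P} → Feasible U P → IntegerPoint P →
  LowerEnvelopeD U (D P) → Induced U P
lowerEnvelopeD⇒induced {n} U {P} feasible@(X≥0 , _ , _ , _ , _ , _ , _ , ΣX≤D) int (v , 0≤v , _ , minimal , unique) =
  let T , stt , dom = Domination.dominating-stt U (X P) X≥0 (integer⇒joined U {P} feasible int) zero
  in T , stt , induced T stt dom
  where
  induced : ∀ T → IsSTTOver U T → (∀ j → Σℚ (λ i → ind (anc? T i j)) ≤ Σℚ (λ i → X P i j)) → InducedBy U T P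
  induced T stt dom = ≐⇒induced {P} (Optimality.minimizer-unique P feasible (obj-cong w λ i → sym (D≡ i)))
    where
    open InducedPoint U T stt
    inProj : InProjD U (D point)
    inProj = point , point-feasible , λ _ → refl
    D≡ : ∀ i → D point i ≡ D P i
    D≡ = unique (D point) inProj
      (≤-antisym (obj-mono 0≤v λ i → ≤-trans (dom i) (ΣX≤D i)) (minimal (D point) inProj))

theorem3p6 : (n : ℕ) (U : Tree (suc n)) (P : Point (suc n))
    → Feasible U P → IntegerPoint P
    → (Induced U P → LowerEnvelope U P)
    × (LowerEnvelopeD U (D P) → Induced U P)
theorem3p6 n U P feasible int = induced⇒lowerEnvelope U feasible , lowerEnvelopeD⇒induced U feasible int
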